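{- Let $\mathcal{L}$ be a fixed first-order language, let $\mathcal{C}$ be a class of countable $\mathcal{L}$-structures, and let $\mathcal{M}\in\mathcal{C}$ be a symmetrically indivisible structure such that $C\lesssim_s\mathcal{M}$ for every $C\in\mathcal{C}$. Let $+^{\mathcal{C}}$ be a binary operation on $\mathcal{C}$ such that for all $C_1,C_2\in\mathcal{C}$, $\mathcal{M}+^{\mathcal{C}}C_1\cong\mathcal{M}+^{\mathcal{C}}C_2$ implies $C_1\cong C_2$, and for all $A,B\in\mathcal{C}$, $A\lesssim_s A+^{\mathcal{C}}B$ and $B\lesssim_s A+^{\mathcal{C}}B$. Then there is a one-to-one map from the structures of $\mathcal{C}$ up to isomorphism into the symmetrically indivisible structures of $\mathcal{C}$ up to isomorphism.
   Context: An embedding $e:\mathcal{N}\to\mathcal{M}$ of $\mathcal{L}$-structures is symmetric if every automorphism of $e[\mathcal{N}]$ extends to an automorphism of $\mathcal{M}$. Write $\mathcal{N}\lesssim_s\mathcal{M}$ if there is a symmetric embedding of $\mathcal{N}$ into $\mathcal{M}$. A substructure is symmetrically embedded if its inclusion map is symmetric. A structure $\mathcal{M}$ is symmetrically indivisible if for every colouring of its universe in two colours there is a monochromatic substructure $\mathcal{M}'\subseteq\mathcal{M}$ such that $\mathcal{M}'\cong\mathcal{M}$ and $\mathcal{M}'$ is symmetrically embedded in $\mathcal{M}$. -}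

module Defs where

open import Level using (Level; _⊔_; suc)
open import Data.Bool.Base using (Bool)
open import Data.Nat.Base using (ℕ)
open import Data.Product.Base using (Σ; ∃; ∃-syntax; _×_; _,_; proj₁; proj₂)
open import Data.Vec.Base using (Vec; []; _∷_; map)
open import Data.Vec.Properties using (map-∘; map-id; map-cong)
open import Data.Vec.Relation.Unary.All using (All; []; _∷_)
open import Function.Base using (_∘_)
open import Function.Bundles using (_↣_; _↔_; _⇔_; mk↣; module Injection; module Inverse; module Equivalence)
open import Function.Construct.Composition using (_↔-∘_; _⇔-∘_)
open import Function.Construct.Identity using (↔-id; ⇔-id)
open import Function.Construct.Symmetry using (↔-sym; ⇔-sym)
open import Relation.Binary.Bundles using (Setoid)
open import Relation.Binary.PropositionalEquality
  using (_≡_; refl; sym; trans; cong; subst; module ≡-Reasoning)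
open import Relation.Unary using (Pred; Irrelevant)

private
  variable
    l a b c ℓ : Level

-- Constant symbols are function symbols of arity 0.
record Language (l : Level) : Set (suc l) where
  field
    Fun     : Set l
    Rel     : Set l
    arityᶠ  : Fun → ℕ
    arityʳ  : Rel → ℕ

record Structure (L : Language l) (a b : Level) : Set (l ⊔ suc (a ⊔ b)) where
  open Language L
  field
    Carrier : Set a
    fun     : (f : Fun) → Vec Carrier (arityᶠ f) → Carrier
    rel     : (r : Rel) → Vec Carrier (arityʳ r) → Set b

open Structure public using (Carrier)

-- Finite structures (including the empty one, if L has no constants) count as countable.
Countable : {L : Language l} → Structure L a b → Set a
Countable M = Carrier M ↣ ℕ

module _ {L : Language l} where
  open Language L

  record IsStrongHomomorphism (M N : Structure L a b)
                              (g : Carrier M → Carrier N) : Set (l ⊔ a ⊔ b) where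
    private
      module M = Structure M
      module N = Structure N
    field
      fun-homo : ∀ f xs → g (M.fun f xs) ≡ N.fun f (map g xs)
      rel-homo : ∀ r xs → M.rel r xs ⇔ N.rel r (map g xs)

  record Embedding (M N : Structure L a b) : Set (l ⊔ a ⊔ b) where
    field
      injection            : Carrier M ↣ Carrier N
      isStrongHomomorphism : IsStrongHomomorphism M N (Injection.to injection)
    open Injection injection public using (to; injective)
    open IsStrongHomomorphism isStrongHomomorphism public

  infix 4 _≅_

  record _≅_ (M N : Structure L a b) : Set (l ⊔ a ⊔ b) where
    field
      inverse              : Carrier M ↔ Carrier N
      isStrongHomomorphism : IsStrongHomomorphism M N (Inverse.to inverse)
    open Inverse inverse public using (to; from; strictlyInverseˡ; strictlyInverseʳ)
    open IsStrongHomomorphism isStrongHomomorphism public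

  Automorphism : Structure L a b → Set (l ⊔ a ⊔ b)
  Automorphism M = M ≅ M

  ≅-refl : {M : Structure L a b} → M ≅ M
  ≅-refl {M = M} = record
    { inverse = ↔-id (Carrier M)
    ; isStrongHomomorphism = record
      { fun-homo = λ f xs → cong (M.fun f) (sym (map-id xs))
      ; rel-homo = λ r xs → subst (λ ys → M.rel r xs ⇔ M.rel r ys) (sym (map-id xs)) (⇔-id _)
      }
    }
    where module M = Structure M

  ≅-sym : {M N : Structure L a b} → M ≅ N → N ≅ M
  ≅-sym {M = M} {N = N} i = record
    { inverse = ↔-sym i.inverse
    ; isStrongHomomorphism = record
      { fun-homo = λ f ys → begin
          i.from (N.fun f ys)                         ≡⟨ cong (i.from ∘ N.fun f) (to-from ys) ⟨
          i.from (N.fun f (map i.to (map i.from ys))) ≡⟨ cong i.from (i.fun-homo f (map i.from ys)) ⟨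
          i.from (i.to (M.fun f (map i.from ys)))     ≡⟨ i.strictlyInverseʳ _ ⟩
          M.fun f (map i.from ys)                     ∎
      ; rel-homo = λ r ys → ⇔-sym
          (subst (λ zs → M.rel r (map i.from ys) ⇔ N.rel r zs) (to-from ys)
                 (i.rel-homo r (map i.from ys)))
      }
    }
    where
    open ≡-Reasoning
    module M = Structure M
    module N = Structure N
    module i = _≅_ i
    to-from : ∀ {n} (ys : Vec (Carrier N) n) → map i.to (map i.from ys) ≡ ys
    to-from ys = trans (sym (map-∘ i.to i.from ys))
                       (trans (map-cong i.strictlyInverseˡ ys) (map-id ys))

  ≅-trans : {M N K : Structure L a b} → M ≅ N → N ≅ K → M ≅ K
  ≅-trans {M = M} {K = K} i j = record
    { inverse = j.inverse ↔-∘ i.inverse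
    ; isStrongHomomorphism = record
      { fun-homo = λ f xs →
          trans (cong j.to (i.fun-homo f xs))
          (trans (j.fun-homo f (map i.to xs))
                 (cong (K.fun f) (sym (map-∘ j.to i.to xs))))
      ; rel-homo = λ r xs →
          subst (λ ys → M.rel r xs ⇔ K.rel r ys) (sym (map-∘ j.to i.to xs))
                (j.rel-homo r (map i.to xs) ⇔-∘ i.rel-homo r xs)
      }
    }
    where
    module M = Structure M
    module K = Structure K
    module i = _≅_ i
    module j = _≅_ j

  -- Membership is proposition-valued, so that the carrier of ⟦ S ⟧ is a subset of
  -- the carrier of M.
  record Substructure (M : Structure L a b) : Set (l ⊔ suc a) where
    private module M = Structure M
    field
      member     : Pred (Carrier M) a
      irrelevant : Irrelevant member
      closed     : ∀ f {xs} → All member xs → member (M.fun f xs)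

  private
    all-proj₂ : {A : Set a} {P : Pred A ℓ} → ∀ {n} (xs : Vec (∃ P) n) → All P (map proj₁ xs)
    all-proj₂ []       = []
    all-proj₂ (x ∷ xs) = proj₂ x ∷ all-proj₂ xs

  ⟦_⟧ : {M : Structure L a b} → Substructure M → Structure L a b
  ⟦_⟧ {M = M} S = record
    { Carrier = ∃ member
    ; fun     = λ f xs → M.fun f (map proj₁ xs) , closed f (all-proj₂ xs)
    ; rel     = λ r xs → M.rel r (map proj₁ xs)
    }
    where
    module M = Structure M
    open Substructure S

  inclusion : {M : Structure L a b} (S : Substructure M) → Embedding ⟦ S ⟧ M
  inclusion S = record
    { injection = mk↣ {to = proj₁} proj₁-injective
    ; isStrongHomomorphism = record
      { fun-homo = λ _ _ → refl
      ; rel-homo = λ _ _ → ⇔-id _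
      }
    }
    where
    open Substructure S
    proj₁-injective : {x y : ∃ member} → proj₁ x ≡ proj₁ y → x ≡ y
    proj₁-injective {_ , p} {_ , q} refl = cong (_ ,_) (irrelevant p q)

  image : {N M : Structure L a b} → Embedding N M → Substructure M
  image {N = N} {M = M} e = record
    { member     = λ y → ∃[ x ] e.to x ≡ y
    ; irrelevant = λ (_ , p) (_ , q) → unique p q (e.injective (trans p (sym q)))
    ; closed     = λ f ps → N.fun f (preimages ps) ,
        trans (e.fun-homo f (preimages ps)) (cong (M.fun f) (map-preimages ps))
    }
    where
    module N = Structure N
    module M = Structure M
    module e = Embedding e

    unique : ∀ {x x′ y} (p : e.to x ≡ y) (q : e.to x′ ≡ y) → x ≡ x′ → (x , p) ≡ (x′ , q)
    unique refl refl refl = refl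

    preimages : ∀ {n} {ys : Vec (Carrier M) n} →
                All (λ y → ∃[ x ] e.to x ≡ y) ys → Vec (Carrier N) n
    preimages []       = []
    preimages (p ∷ ps) = proj₁ p ∷ preimages ps

    map-preimages : ∀ {n} {ys : Vec (Carrier M) n} (ps : All (λ y → ∃[ x ] e.to x ≡ y) ys) →
                    map e.to (preimages ps) ≡ ys
    map-preimages []                = refl
    map-preimages ((_ , refl) ∷ ps) = cong (_ ∷_) (map-preimages ps)

  Extends : {M : Structure L a b} {S : Substructure M} →
            Automorphism M → Automorphism ⟦ S ⟧ → Set a
  Extends σ τ = ∀ x → _≅_.to σ (proj₁ x) ≡ proj₁ (_≅_.to τ x)

  Symmetric : {N M : Structure L a b} → Embedding N M → Set (l ⊔ a ⊔ b)
  Symmetric {M = M} e =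
    (τ : Automorphism ⟦ image e ⟧) → Σ (Automorphism M) λ σ → Extends {S = image e} σ τ

  infix 4 _≲ₛ_

  _≲ₛ_ : Structure L a b → Structure L a b → Set (l ⊔ a ⊔ b)
  N ≲ₛ M = Σ (Embedding N M) Symmetric

  SymmetricallyEmbedded : {M : Structure L a b} → Substructure M → Set (l ⊔ a ⊔ b)
  SymmetricallyEmbedded S = Symmetric (inclusion S)

  Monochromatic : {M : Structure L a b} → (Carrier M → Bool) → Substructure M → Set a
  Monochromatic χ S = ∃[ i ] (∀ {x} → Substructure.member S x → χ x ≡ i)

  SymmetricallyIndivisible : Structure L a b → Set (l ⊔ suc a ⊔ b)
  SymmetricallyIndivisible M =
    (χ : Carrier M → Bool) →
    Σ (Substructure M) λ S → Monochromatic χ S × ⟦ S ⟧ ≅ M × SymmetricallyEmbedded S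

  -- The members of a class, with isomorphism as the equality.
  _/≅ : Pred (Structure L a b) c → Setoid (l ⊔ suc (a ⊔ b) ⊔ c) (l ⊔ a ⊔ b)
  𝒞 /≅ = record
    { Carrier       = ∃ 𝒞
    ; _≈_           = λ A B → proj₁ A ≅ proj₁ B
    ; isEquivalence = record { refl = ≅-refl ; sym = ≅-sym ; trans = ≅-trans }
    }

-- Zermelo's axiom of choice, in the form: every equivalence relation has a system of
-- unique representatives.  It is not derivable in Agda.  It is needed to speak of maps on
-- isomorphism classes induced by an operation on structures that is not assumed to
-- respect isomorphism.
AxiomOfChoice : (c ℓ : Level) → Set (suc (c ⊔ ℓ))
AxiomOfChoice c ℓ =
  (S : Setoid c ℓ) → let open Setoid S renaming (Carrier to X) in
  Σ (X → X) λ rep → (∀ x → rep x ≈ x) × (∀ {x y} → x ≈ y → rep x ≡ rep y)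

{-# OPTIONS --safe #-}

-- If M is symmetrically indivisible and N and M embed symmetrically into each other, then N is
-- symmetrically indivisible: pull a colouring of N back to M, take a monochromatic symmetric copy
-- S of M in M, and push N through N → M ≅ S ⊆ M → N.  This applies to N = M ⊕ A for every A, and
-- A ↦ M ⊕ A is injective up to isomorphism by cancellation; choosing representatives makes it
-- well defined on isomorphism classes.
module Submission where

open import Level using (Level; _⊔_; suc)
open import Algebra.Core using (Op₂)
open import Data.Product.Base using (Σ; ∃; _×_; _,_; proj₁; proj₂)
open import Data.Vec.Base using (map)
open import Data.Vec.Properties using (map-∘)
open import Function.Base using (_∘_)
open import Function.Bundles using (Injection; _⇔_; mk↔ₛ′)
open import Function.Construct.Composition using (_↣-∘_; _⇔-∘_)
open import Function.Properties.Inverse using (Inverse⇒Injection)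
open import Relation.Binary.PropositionalEquality
  using (_≡_; refl; sym; trans; cong; subst)
open import Relation.Unary using (Pred; _∩_)
open import Defs

private
  variable
    l a b : Level

module _ {L : Language l} where

  private
    variable
      N M K : Structure L a b

  ≅⇒Embedding : N ≅ M → Embedding N M
  ≅⇒Embedding i = record
    { injection            = Inverse⇒Injection (_≅_.inverse i)
    ; isStrongHomomorphism = _≅_.isStrongHomomorphism i
    }

  infixr 9 _∘ᵉ_

  _∘ᵉ_ : Embedding M K → Embedding N M → Embedding N K
  _∘ᵉ_ {K = K} g e = record
    { injection            = g.injection ↣-∘ e.injection
    ; isStrongHomomorphism = record
      { fun-homo = λ f xs →
          trans (cong g.to (e.fun-homo f xs))
          (trans (g.fun-homo f (map e.to xs))
                 (cong (K.fun f) (sym (map-∘ g.to e.to xs))))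
      ; rel-homo = λ r xs →
          subst (λ ys → _ ⇔ K.rel r ys) (sym (map-∘ g.to e.to xs))
                (g.rel-homo r (map e.to xs) ⇔-∘ e.rel-homo r xs)
      }
    }
    where
    module K = Structure K
    module g = Embedding g
    module e = Embedding e

  -- A point of the image carries its preimage in its membership proof, so the inverse is a
  -- projection.
  ≅-image : (e : Embedding N M) → N ≅ ⟦ image e ⟧
  ≅-image {N = N} {M = M} e = record
    { inverse = mk↔ₛ′ corestrict (proj₁ ∘ proj₂) (λ { (_ , _ , refl) → refl }) (λ _ → refl)
    ; isStrongHomomorphism = record
      { fun-homo = λ f xs → Embedding.injective (inclusion (image e))
          (trans (e.fun-homo f xs) (cong (M.fun f) (map-∘ proj₁ corestrict xs)))
      ; rel-homo = λ r xs →
          subst (λ ys → N.rel r xs ⇔ M.rel r ys) (map-∘ proj₁ corestrict xs) (e.rel-homo r xs)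
      }
    }
    where
    module N = Structure N
    module M = Structure M
    module e = Embedding e
    corestrict : Carrier N → Carrier ⟦ image e ⟧
    corestrict x = e.to x , x , refl

  -- Symmetry stated on the domain rather than on the image, so that it visibly composes.
  LiftsAutomorphisms : {N M : Structure L a b} → Embedding N M → Set _
  LiftsAutomorphisms {N = N} {M = M} e =
    (τ : Automorphism N) → Σ (Automorphism M) λ σ →
    ∀ x → _≅_.to σ (Embedding.to e x) ≡ Embedding.to e (_≅_.to τ x)

  -- Conjugating by `≅-image e` moves automorphisms between `N` and the image.
  symmetric⇒lifts : (e : Embedding N M) → Symmetric e → LiftsAutomorphisms e
  symmetric⇒lifts e sym-e τ
    with σ , ext ← sym-e (≅-trans (≅-sym (≅-image e)) (≅-trans τ (≅-image e)))
    = σ , λ x → ext (_≅_.to (≅-image e) x)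

  lifts⇒symmetric : (e : Embedding N M) → LiftsAutomorphisms e → Symmetric e
  lifts⇒symmetric e lifts-e τ
    with σ , ext ← lifts-e (≅-trans (≅-image e) (≅-trans τ (≅-sym (≅-image e))))
    -- The membership proof of the `τ`-value identifies `e` of its preimage with its underlying
    -- point.
    = σ , λ { (_ , x , refl) → trans (ext x) (proj₂ (proj₂ (_≅_.to τ (_ , x , refl)))) }

  ∘ᵉ-lifts : (g : Embedding M K) (e : Embedding N M) →
             LiftsAutomorphisms g → LiftsAutomorphisms e → LiftsAutomorphisms (g ∘ᵉ e)
  ∘ᵉ-lifts g e lifts-g lifts-e τ
    with σ , σ-lifts ← lifts-e τ
    with ρ , ρ-lifts ← lifts-g σ
    = ρ , λ x → trans (ρ-lifts (Embedding.to e x)) (cong (Embedding.to g) (σ-lifts x))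

  ≅-lifts : (i : N ≅ M) → LiftsAutomorphisms (≅⇒Embedding i)
  ≅-lifts i τ = ≅-trans (≅-sym i) (≅-trans τ i) ,
    λ x → cong (i.to ∘ _≅_.to τ) (i.strictlyInverseʳ x)
    where module i = _≅_ i

  ≅⇒≲ₛ : N ≅ M → N ≲ₛ M
  ≅⇒≲ₛ i = ≅⇒Embedding i , lifts⇒symmetric (≅⇒Embedding i) (≅-lifts i)

  ≲ₛ-trans : N ≲ₛ M → M ≲ₛ K → N ≲ₛ K
  ≲ₛ-trans (e , sym-e) (g , sym-g) = g ∘ᵉ e ,
    lifts⇒symmetric (g ∘ᵉ e)
      (∘ᵉ-lifts g e (symmetric⇒lifts g sym-g) (symmetric⇒lifts e sym-e))

  symmetricallyIndivisible-resp-≲ₛ :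
    N ≲ₛ M → M ≲ₛ N → SymmetricallyIndivisible M → SymmetricallyIndivisible N
  symmetricallyIndivisible-resp-≲ₛ N≲M M≲N@(g , _) indivisible χ
    with S , (i , mono) , S≅M , sym-S ← indivisible (χ ∘ Embedding.to g)
    -- Each value of `h` is `g` applied to a member of `S`, so its colour under `χ` is the
    -- pulled-back colour of that member.
    = image h , (i , λ { (x , refl) → mono (proj₂ (Embedding.to (proj₁ N≲S) x)) }) ,
      -- Lifting automorphisms along the inclusion of `image h` is, by definition, symmetry of `h`.
      ≅-sym (≅-image h) , lifts⇒symmetric (inclusion (image h)) (proj₂ N≲N)
    where
    N≲S = ≲ₛ-trans N≲M (≅⇒≲ₛ (≅-sym S≅M))
    N≲N = ≲ₛ-trans N≲S (≲ₛ-trans (inclusion S , sym-S) M≲N)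
    h   = proj₁ N≲N

proposition2p17 : {l a b c : Level} →
    AxiomOfChoice (l ⊔ suc (a ⊔ b) ⊔ c) (l ⊔ a ⊔ b) →
    (L : Language l) (𝒞 : Pred (Structure L a b) c) →
    (∀ {A} → 𝒞 A → Countable A) →
    (M : ∃ 𝒞) →
    SymmetricallyIndivisible (proj₁ M) →
    ((A : ∃ 𝒞) → proj₁ A ≲ₛ proj₁ M) →
    (_⊕_ : Op₂ (∃ 𝒞)) →
    (∀ A B → proj₁ (M ⊕ A) ≅ proj₁ (M ⊕ B) → proj₁ A ≅ proj₁ B) →
    (∀ A B → (proj₁ A ≲ₛ proj₁ (A ⊕ B)) × (proj₁ B ≲ₛ proj₁ (A ⊕ B))) →
    Injection (𝒞 /≅) ((𝒞 ∩ SymmetricallyIndivisible) /≅)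
proposition2p17 choice L 𝒞 countable M indivisible universal _⊕_ cancel summands
  with rep , rep≅ , rep-cong ← choice (𝒞 /≅) = record
  { to = λ A → let N = M ⊕ rep A in
      proj₁ N , proj₂ N ,
      -- `N` lies in `𝒞`, hence embeds symmetrically into `M`; conversely `M` is its left summand.
      symmetricallyIndivisible-resp-≲ₛ (universal N) (proj₁ (summands M (rep A))) indivisible
  ; cong = λ {A} {B} A≅B →
      -- Isomorphic structures have equal representatives, so `⊕` is only ever compared on equal
      -- arguments.
      subst (λ R → proj₁ (M ⊕ rep A) ≅ proj₁ (M ⊕ R)) (rep-cong {A} {B} A≅B) ≅-refl
  ; injective = λ {A} {B} i →
      ≅-trans (≅-sym (rep≅ A)) (≅-trans (cancel (rep A) (rep B) i) (rep≅ B))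
  }
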